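{- Let $\lambda$ be a strict partition of $n$. The restricted dual equivalences $d_i^R$, $i\in[2,n-2]$, act transitively on $\mathrm{SSYT}(\lambda)$ via the flip of the row reading word: for each $T\in\mathrm{SSYT}(\lambda)$ there is a unique $T'\in\mathrm{SSYT}(\lambda)$ with $\mathrm{flip}(\mathrm{rw}(T'))=d_i^R(\mathrm{flip}(\mathrm{rw}(T)))$, and any two elements of $\mathrm{SSYT}(\lambda)$ are connected by a finite sequence of such moves $T\mapsto T'$.
   Context: A strict partition is $\lambda=(\lambda_1>\lambda_2>\dots>\lambda_k>0)$. Its shifted shape is the set of squares in row $r$ and column $c$ with $1\le r\le k$ and $r\le c\le\lambda_r+r-1$, with rows numbered from bottom to top. $\mathrm{SSYT}(\lambda)$ here denotes the set of standard shifted tableaux of shifted shape $\lambda$: fillings of the shifted shape using each of $1,\dots,n$ once, increasing left to right along rows and bottom to top up columns. The row reading word $\mathrm{rw}(T)$ reads each row left to right, starting with the top row and going down. Permutations are in one-line notation. $\mathrm{ID}(\pi)$ is the set of $i\in[n-1]$ such that $i$ occurs to the right of $i+1$. $\mathrm{flip}(\pi)$ is obtained by reading $\pi$ from right to left and then replacing each value $v$ by $n+1-v$. $d_i$ acts on a permutation by: $\ldots i\ldots i-1\ldots i+1\ldots\leftrightarrow\ldots i+1\ldots i-1\ldots i\ldots$ and $\ldots i\ldots i+1\ldots i-1\ldots\leftrightarrow\ldots i-1\ldots i+1\ldots i\ldots$ (all else fixed), and as the identity if $i$ is between $i-1$ and $i+1$. For $i\in[2,n-2]$, $d_i^R(\pi)=\pi$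 if $i+1\in\mathrm{ID}(\pi)\cap\mathrm{ID}(d_i(\pi))$, and $d_i^R(\pi)=d_i(\pi)$ otherwise. -}

module Defs where

open import Data.Nat using (ℕ; zero; suc; pred; _+_; _∸_; _≤_; _<_; _>_; _≟_; _≤?_; _<?_)
open import Data.Bool using (if_then_else_)
open import Data.List using (List; []; _∷_; length; map; reverse; concatMap; upTo; downFrom)
open import Data.Nat.ListAction using (sum)
open import Data.List.Relation.Unary.All using (All)
open import Data.List.Relation.Unary.Linked using (Linked)
open import Data.Product using (_×_; _,_; ∃-syntax; ∃!)
open import Data.Sum using (_⊎_)
open import Level using (0ℓ)
open import Relation.Binary.Construct.Closure.ReflexiveTransitive using (Star)
open import Relation.Binary.PropositionalEquality using (_≡_)
open import Relation.Nullary using (Dec; does)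
open import Relation.Nullary.Decidable using (_×-dec_; _⊎-dec_)
open import Relation.Unary using (Pred; Decidable; _∈_; _∩_)
open import Relation.Unary.Properties using (_∩?_)

record StrictPartition (n : ℕ) : Set where
  field
    parts      : List ℕ
    decreasing : Linked _>_ parts
    positive   : All (_> 0) parts
    sum≡n      : sum parts ≡ n

-- Parts are numbered from 1; the value is 0 outside the range 1 … length.
part : List ℕ → ℕ → ℕ
part []       _             = 0
part (_ ∷ _)  zero          = 0
part (x ∷ _)  (suc zero)    = x
part (_ ∷ xs) (suc (suc r)) = part xs (suc r)

module _ {n : ℕ} (μ : StrictPartition n) where
  open StrictPartition μ

  -- A cell is a pair (row , column), both numbered from 1, row 1 at the bottom.
  Shape : Pred (ℕ × ℕ) 0ℓ
  Shape (r , c) = (1 ≤ r × r ≤ length parts) × (r ≤ c × c ≤ part parts r + r ∸ 1)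

  -- Only the values of entry on the cells of the shape are meaningful: see _≈_.
  record SSYT : Set where
    field
      entry       : ℕ → ℕ → ℕ
      entry-range : ∀ {r c} → (r , c) ∈ Shape → 1 ≤ entry r c × entry r c ≤ n
      entry-once  : ∀ v → 1 ≤ v → v ≤ n →
                    ∃! _≡_ λ ((r , c) : ℕ × ℕ) → (r , c) ∈ Shape × entry r c ≡ v
      row-incr    : ∀ {r c c′} → (r , c) ∈ Shape → (r , c′) ∈ Shape →
                    c < c′ → entry r c < entry r c′
      col-incr    : ∀ {r r′ c} → (r , c) ∈ Shape → (r′ , c) ∈ Shape →
                    r < r′ → entry r c < entry r′ c

module _ {n : ℕ} {μ : StrictPartition n} where
  open StrictPartition μ
  open SSYT

  infix 4 _≈_

  _≈_ : SSYT μ → SSYT μ → Set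
  T ≈ T′ = ∀ {r c} → (r , c) ∈ Shape μ → entry T r c ≡ entry T′ r c

  -- Row r consists of the columns r , r + 1 , … , r + part r ∸ 1, and the rows
  -- are visited in the order length parts , … , 2 , 1.
  rw : SSYT μ → List ℕ
  rw T = concatMap row (map suc (downFrom (length parts)))
    where
    row : ℕ → List ℕ
    row r = map (λ j → entry T r (r + j)) (upTo (part parts r))

-- Permutations in one-line notation.  The operations below are defined on all
-- words over ℕ, but carry their meaning only on permutations of 1 , … , length.
Word : Set
Word = List ℕ

-- The position of the first occurrence of v (the length of the word if none).
pos : ℕ → Word → ℕ
pos v []      = 0
pos v (x ∷ w) = if does (v ≟ x) then 0 else suc (pos v w)

ID : Word → Pred ℕ 0ℓ
ID π i = (1 ≤ i × i < length π) × pos (suc i) π < pos i π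

ID? : (π : Word) → Decidable (ID π)
ID? π i = (1 ≤? i ×-dec i <? length π) ×-dec pos (suc i) π <? pos i π

flip : Word → Word
flip π = map (λ v → suc (length π) ∸ v) (reverse π)

Between : Word → ℕ → ℕ → ℕ → Set
Between π a x b = (pos a π < pos x π × pos x π < pos b π)
                ⊎ (pos b π < pos x π × pos x π < pos a π)

between? : ∀ π a x b → Dec (Between π a x b)
between? π a x b = (pos a π <? pos x π ×-dec pos x π <? pos b π)
             ⊎-dec (pos b π <? pos x π ×-dec pos x π <? pos a π)

exchange : ℕ → ℕ → Word → Word
exchange a b = map λ v → if does (v ≟ a) then b else if does (v ≟ b) then a else v

-- The first branch is  … i … i-1 … i+1 …  ↔  … i+1 … i-1 … i …,
-- the second is        … i … i+1 … i-1 …  ↔  … i-1 … i+1 … i …;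
-- in the remaining case i lies between i-1 and i+1.
d : ℕ → Word → Word
d i π = if does (between? π i (pred i) (suc i)) then exchange i (suc i) π
        else if does (between? π i (suc i) (pred i)) then exchange i (pred i) π
        else π

dᴿ : ℕ → Word → Word
dᴿ i π = if does ((ID? π ∩? ID? (d i π)) (suc i)) then π else d i π

module _ {n : ℕ} {μ : StrictPartition n} where

  Moves : ℕ → SSYT μ → SSYT μ → Set
  Moves i T T′ = flip (rw T′) ≡ dᴿ i (flip (rw T))

  -- i ranges over [2 , n - 2].
  Move : SSYT μ → SSYT μ → Set
  Move T T′ = ∃[ i ] 2 ≤ i × i + 2 ≤ n × Moves i T T′

  -- The endpoint is compared by _≈_ because the empty sequence of moves must
  -- connect any two representatives of the same filling.
  Connected : SSYT μ → SSYT μ → Set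
  Connected T T′ = ∃[ U ] Star Move T U × U ≈ T′

{-# OPTIONS --safe #-}
-- Write a cell's entry v as n + 1 - v: the flipped reading word lists the cells row by row from the bottom,
-- each row from right to left, and the move dᴿ (n - a) exchanges a + 1 with a or a + 2.
--
-- Transitivity: suppose T and T′ agree above m but have m in different cells, one of them, P, in a higher row
-- than the other, Q. Repeatedly exchanging consecutive entries rearranges the entries below m in T, keeping it
-- standard, so that m ∸ 1 takes the remaining one of P and Q, m ∸ 2 a corner C in the row just below P, and
-- m ∸ 3 a corner weakly above and to the right of the left neighbour of C. Then C lies between P and Q in the
-- reading word and m ∸ 3 is read before m ∸ 2, so the restriction is not triggered and a single move exchanges
-- m and m ∸ 1. Tableaux that agree from m on are connected by induction on m.
module Submission where

open import Defs
open import Data.Bool using (if_then_else_)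
open import Data.Empty using (⊥; ⊥-elim)
open import Data.List using (List; []; _∷_; length; map; reverse; concatMap; upTo; downFrom)
open import Data.List.Membership.Propositional using (find; lose) renaming (_∈_ to _∈ˡ_)
open import Data.List.Membership.Propositional.Properties
  using (∈-map⁺; ∈-map⁻; ∈-concatMap⁺; ∈-concatMap⁻; ∈-upTo⁺; ∈-upTo⁻; ∈-downFrom⁺; ∈-downFrom⁻)
open import Data.List.Properties
  using (length-map; length-++; length-reverse; length-upTo; map-∘; map-cong; map-cong-local; map-concatMap;
         concatMap-cong; ∷-injective; reverse-map; unfold-reverse)
open import Data.List.Relation.Unary.All as All using (All; []; _∷_)
import Data.List.Relation.Unary.All.Properties as All
open import Data.List.Relation.Unary.AllPairs using (AllPairs; []; _∷_)
import Data.List.Relation.Unary.AllPairs.Properties as AllPairs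
open import Data.List.Relation.Unary.Any using (here; there)
import Data.List.Relation.Unary.Any.Properties as Any
open import Data.List.Relation.Unary.Linked using (Linked; []; [-]; _∷_)
open import Data.Nat using (ℕ; zero; suc; pred; _+_; _∸_; _≤_; _<_; _>_; z≤n; s≤s; _≟_; _≤?_; _<?_)
open import Data.Nat.ListAction using (sum)
open import Data.Nat.Properties
open import Data.Product using (_×_; _,_; proj₁; proj₂; ∃; ∃!)
open import Data.Sum using (_⊎_; inj₁; inj₂; swap)
open import Function using (_∘_; id)
open import Level using (0ℓ)
open import Relation.Binary using (Rel; tri<; tri≈; tri>)
open import Relation.Binary.Construct.Closure.ReflexiveTransitive using (Star; ε; _◅_; _◅◅_)
open import Relation.Binary.PropositionalEquality
open import Relation.Nullary using (Dec; does; yes; no; ¬_)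
open import Relation.Nullary.Decidable using (_×-dec_; dec-true; dec-false)
open import Relation.Unary using (_∈_)
open import Relation.Unary.Properties using (_∩?_)

-- Conditionals and transpositions of two values.

module _ {a p} {A : Set a} {P : Set p} (P? : Dec P) {x y : A} where

  if-yes : P → (if does P? then x else y) ≡ x
  if-yes p = cong (if_then x else y) (dec-true P? p)

  if-no : ¬ P → (if does P? then x else y) ≡ y
  if-no ¬p = cong (if_then x else y) (dec-false P? ¬p)

transp : ℕ → ℕ → ℕ → ℕ
transp a b v = if does (v ≟ a) then b else if does (v ≟ b) then a else v

module _ (a b : ℕ) where

  transp-left : ∀ {v} → v ≡ a → transp a b v ≡ b
  transp-left {v} p = if-yes (v ≟ a) p

  transp-right : ∀ {v} → v ≡ b → transp a b v ≡ a
  transp-right {v} p with v ≟ a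
  ... | yes q = trans (if-yes (v ≟ a) q) (trans (sym p) q)
  ... | no ¬q = trans (if-no (v ≟ a) ¬q) (if-yes (v ≟ b) p)

  transp-other : ∀ {v} → v ≢ a → v ≢ b → transp a b v ≡ v
  transp-other {v} p q = trans (if-no (v ≟ a) p) (if-no (v ≟ b) q)

transp-comm : ∀ a b v → transp a b v ≡ transp b a v
transp-comm a b v with v ≟ a | v ≟ b
... | yes p | _     = trans (transp-left a b p) (sym (transp-right b a p))
... | no _  | yes q = trans (transp-right a b q) (sym (transp-left b a q))
... | no p  | no q  = trans (transp-other a b p q) (sym (transp-other b a q p))

transp-involutive : ∀ a b v → transp a b (transp a b v) ≡ v
transp-involutive a b v with v ≟ a | v ≟ b
... | yes p | _     = trans (cong (transp a b) (transp-left a b p)) (trans (transp-right a b refl) (sym p))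
... | no _  | yes q = trans (cong (transp a b) (transp-right a b q)) (trans (transp-left a b refl) (sym q))
... | no p  | no q  = trans (cong (transp a b) (transp-other a b p q)) (transp-other a b p q)

transp-injective : ∀ a b {v w} → transp a b v ≡ transp a b w → v ≡ w
transp-injective a b {v} {w} p =
  trans (sym (transp-involutive a b v)) (trans (cong (transp a b) p) (transp-involutive a b w))

-- Truncated subtraction from `m` is injective only on values up to `m`, hence the three bounds.
transp-∸ : ∀ {m a b v} → a ≤ m → b ≤ m → v ≤ m →
           m ∸ transp a b v ≡ transp (m ∸ a) (m ∸ b) (m ∸ v)
transp-∸ {m} {a} {b} {v} a≤m b≤m v≤m with v ≟ a | v ≟ b
... | yes p | _     = trans (cong (m ∸_) (transp-left a b p)) (sym (transp-left _ _ (cong (m ∸_) p)))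
... | no _  | yes q = trans (cong (m ∸_) (transp-right a b q)) (sym (transp-right _ _ (cong (m ∸_) q)))
... | no p  | no q  = trans (cong (m ∸_) (transp-other a b p q))
  (sym (transp-other _ _ (p ∘ ∸-cancelˡ-≡ v≤m a≤m) (q ∘ ∸-cancelˡ-≡ v≤m b≤m)))

-- No number lies strictly between `a` and `suc a`, so exchanging them reverses the comparison of
-- that one pair only.
transp-suc-mono-< : ∀ {a v w} → v < w → ¬ (v ≡ a × w ≡ suc a) →
                    transp a (suc a) v < transp a (suc a) w
transp-suc-mono-< {a} {v} {w} v<w ¬aw with v ≟ a | v ≟ suc a | w ≟ a | w ≟ suc a
... | yes p | _ | _ | yes q = ⊥-elim (¬aw (p , q))
... | yes refl | _ | yes refl | _ = ⊥-elim (<-irrefl refl v<w)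
... | yes refl | _ | no q | no q′ =
  subst₂ _<_ (sym (transp-left a _ refl)) (sym (transp-other a _ q q′)) (≤∧≢⇒< v<w (q′ ∘ sym))
... | no p | yes refl | yes refl | _ = ⊥-elim (<-asym v<w (n<1+n _))
... | no p | yes refl | no _ | yes refl = ⊥-elim (<-irrefl refl v<w)
... | no p | yes refl | no q | no q′ =
  subst₂ _<_ (sym (transp-right a (suc a) refl)) (sym (transp-other a _ q q′)) (<-trans (n<1+n _) v<w)
... | no p | no p′ | yes refl | _ =
  subst₂ _<_ (sym (transp-other a _ p p′)) (sym (transp-left a _ refl)) (<-trans v<w (n<1+n _))
... | no p | no p′ | no _ | yes refl =
  subst₂ _<_ (sym (transp-other a _ p p′)) (sym (transp-right a (suc a) refl)) (≤∧≢⇒< (≤-pred v<w) p)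
... | no p | no p′ | no q | no q′ =
  subst₂ _<_ (sym (transp-other a _ p p′)) (sym (transp-other a _ q q′)) v<w

-- Positions in words and sorted lists.

pos-here : ∀ {v x} w → v ≡ x → pos v (x ∷ w) ≡ 0
pos-here {v} {x} _ p = if-yes (v ≟ x) p

pos-there : ∀ {v x} w → v ≢ x → pos v (x ∷ w) ≡ suc (pos v w)
pos-there {v} {x} _ p = if-no (v ≟ x) p

-- `pos` finds a first occurrence, so `f` has to separate the elements of the list. Asymmetry of `R`
-- rules out repetitions and pairs listed in the opposite order.
pos-mono : ∀ {A : Set} {R : Rel A 0ℓ} (f : A → ℕ) {xs} → AllPairs R xs →
           (∀ {x y} → R x y → ¬ R y x) →
           (∀ {x y} → x ∈ˡ xs → y ∈ˡ xs → f x ≡ f y → x ≡ y) →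
           ∀ {x y} → x ∈ˡ xs → y ∈ˡ xs → R x y → pos (f x) (map f xs) < pos (f y) (map f xs)
pos-mono f (_ ∷ _) asym inj (here refl) (here refl) xRy = ⊥-elim (asym xRy xRy)
pos-mono {R = R} f {_ ∷ zs} (_ ∷ _) asym inj (here refl) y∈@(there _) xRy =
  subst₂ _<_ (sym (pos-here (map f zs) refl)) (sym (pos-there (map f zs) fy≢fx)) (s≤s z≤n)
  where
  fy≢fx = λ p → asym xRy (subst₂ R (inj (here refl) y∈ (sym p)) (inj y∈ (here refl) p) xRy)
pos-mono f (z ∷ _) asym inj (there x∈) (here refl) xRy = ⊥-elim (asym xRy (All.lookup z x∈))
pos-mono {R = R} f {z ∷ zs} (z< ∷ zs<) asym inj {x} {y} (there x∈) (there y∈) xRy =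
  subst₂ _<_ (sym (pos-there (map f zs) (f≢ x∈))) (sym (pos-there (map f zs) (f≢ y∈)))
    (s≤s (pos-mono f zs< asym (λ p q → inj (there p) (there q)) x∈ y∈ xRy))
  where
  f≢ : ∀ {v} → v ∈ˡ zs → f v ≢ f z
  f≢ v∈ p with refl ← inj (there v∈) (here refl) p = let r = All.lookup z< v∈ in asym r r

AllPairs-reverse⁺ : ∀ {A : Set} {R : Rel A 0ℓ} {xs} → AllPairs R xs →
                    AllPairs (λ x y → R y x) (reverse xs)
AllPairs-reverse⁺ [] = []
AllPairs-reverse⁺ {R = R} {x ∷ xs} (px ∷ pxs) = subst (AllPairs _) (sym (unfold-reverse x xs))
  (AllPairs.++⁺ (AllPairs-reverse⁺ pxs) ([] ∷ [])
    (All.tabulate λ y∈ → All.lookup px (Any.reverse⁻ y∈) ∷ []))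

map-≡⇒≗ : ∀ {A B : Set} {f g : A → B} xs → map f xs ≡ map g xs → ∀ {x} → x ∈ˡ xs → f x ≡ g x
map-≡⇒≗ (_ ∷ _)  p (here refl) = proj₁ (∷-injective p)
map-≡⇒≗ (_ ∷ xs) p (there x∈) = map-≡⇒≗ xs (proj₂ (∷-injective p)) x∈

-- Parts of a partition and sums over lists.

part-decreasing : ∀ {ps} → Linked _>_ ps → ∀ {r} → suc (suc r) ≤ length ps →
                  part ps (suc (suc r)) < part ps (suc r)
part-decreasing [-] {r} (s≤s ())
part-decreasing (x>y ∷ _)  {zero}  _ = x>y
part-decreasing (_ ∷ link) {suc r} (s≤s le) = part-decreasing link le

-- `downFrom` ends with index 0, while recursion on the parts removes index 0 first, so the last
-- summand is moved to the front.
sum-map-downFrom : ∀ (g : ℕ → ℕ) k →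
                   sum (map g (downFrom (suc k))) ≡ g 0 + sum (map (g ∘ suc) (downFrom k))
sum-map-downFrom g zero    = refl
sum-map-downFrom g (suc k) = begin
  g (suc k) + sum (map g (downFrom (suc k)))                ≡⟨ cong (g (suc k) +_) (sum-map-downFrom g k) ⟩
  g (suc k) + (g 0 + sum (map (g ∘ suc) (downFrom k)))      ≡⟨ +-assoc (g (suc k)) (g 0) _ ⟨
  (g (suc k) + g 0) + sum (map (g ∘ suc) (downFrom k))
    ≡⟨ cong (_+ sum (map (g ∘ suc) (downFrom k))) (+-comm (g (suc k)) (g 0)) ⟩
  (g 0 + g (suc k)) + sum (map (g ∘ suc) (downFrom k))      ≡⟨ +-assoc (g 0) (g (suc k)) _ ⟩
  g 0 + (g (suc k) + sum (map (g ∘ suc) (downFrom k)))      ∎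
  where open ≡-Reasoning

sum-parts : ∀ ps → sum (map (part ps ∘ suc) (downFrom (length ps))) ≡ sum ps
sum-parts []       = refl
sum-parts (x ∷ ps) = trans (sum-map-downFrom (part (x ∷ ps) ∘ suc) (length ps)) (cong (x +_) (sum-parts ps))

length-concatMap : ∀ {A B : Set} (f : A → List B) xs → length (concatMap f xs) ≡ sum (map (length ∘ f) xs)
length-concatMap f []       = refl
length-concatMap f (x ∷ xs) = trans (length-++ (f x)) (cong (length (f x) +_) (length-concatMap f xs))

-- Cells and the orders on them.

Cell : Set
Cell = ℕ × ℕ

row col : Cell → ℕ
row = proj₁
col = proj₂

infix 4 _⋖_ _≺_

-- Not a covering relation: cells at any distance in one row or column count, as in `row-incr` and
-- `col-incr`.
_⋖_ : Rel Cell 0ℓ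
x ⋖ y = (row x ≡ row y × col x < col y) ⊎ (col x ≡ col y × row x < row y)

-- The order of occurrence of the cells in the flipped reading word.
_≺_ : Rel Cell 0ℓ
x ≺ y = row x < row y ⊎ (row x ≡ row y × col y < col x)

≺-asym : ∀ {x y} → x ≺ y → ¬ y ≺ x
≺-asym (inj₁ p) (inj₁ q) = <-asym p q
≺-asym (inj₁ p) (inj₂ (q , _)) = <-irrefl (sym q) p
≺-asym (inj₂ (p , _)) (inj₁ q) = <-irrefl (sym p) q
≺-asym (inj₂ (_ , p)) (inj₂ (_ , q)) = <-asym p q

≺-trans : ∀ {x y z} → x ≺ y → y ≺ z → x ≺ z
≺-trans (inj₁ p) (inj₁ q) = inj₁ (<-trans p q)
≺-trans (inj₁ p) (inj₂ (refl , _)) = inj₁ p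
≺-trans (inj₂ (refl , _)) (inj₁ q) = inj₁ q
≺-trans (inj₂ (refl , p)) (inj₂ (refl , q)) = inj₂ (refl , <-trans q p)

≺-compare : ∀ x y → x ≺ y ⊎ x ≡ y ⊎ y ≺ x
≺-compare (r , c) (r′ , c′) with <-cmp r r′
... | tri< p _ _ = inj₁ (inj₁ p)
... | tri> _ _ p = inj₂ (inj₂ (inj₁ p))
... | tri≈ _ refl _ with <-cmp c c′
...   | tri< p _ _ = inj₂ (inj₂ (inj₂ (refl , p)))
...   | tri≈ _ refl _ = inj₂ (inj₁ refl)
...   | tri> _ _ p = inj₁ (inj₂ (refl , p))

-- Geometry of the shifted shape and the list of its cells.

module _ {n : ℕ} (μ : StrictPartition n) where
  open StrictPartition μ

  private
    S = Shape μ

  -- Writing the row as `suc r` removes the truncated `∸ 1` from `Shape`: the last column becomes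
  -- `part parts (suc r) + r`.
  Shape-intro : ∀ {r c} → suc r ≤ length parts → suc r ≤ c → c ≤ part parts (suc r) + r → S (suc r , c)
  Shape-intro {r} p q s = (s≤s z≤n , p) , q , ≤-trans s (≤-reflexive (cong pred (sym (+-suc _ r))))

  Shape-bound : ∀ {r c} → S (suc r , c) → c ≤ part parts (suc r) + r
  Shape-bound {r} (_ , _ , s) = ≤-trans s (≤-reflexive (cong pred (+-suc _ r)))

  Shape-left : ∀ {r c c′} → S (r , c) → r ≤ c′ → c′ ≤ c → S (r , c′)
  Shape-left (p , _ , s) q c′≤c = p , q , ≤-trans c′≤c s

  -- The strict decrease of the parts makes up for the shift by one column, so a row ends weakly to
  -- the right of the row above it.
  Shape-below : ∀ {r c} → S (suc (suc r) , c) → S (suc r , c)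
  Shape-below {r} {c} x∈@((_ , p) , q , _) = Shape-intro (<⇒≤ p) (<⇒≤ q) (begin
    c                                 ≤⟨ Shape-bound x∈ ⟩
    part parts (suc (suc r)) + suc r  ≡⟨ +-suc _ r ⟩
    suc (part parts (suc (suc r))) + r ≤⟨ +-monoˡ-≤ r (part-decreasing decreasing p) ⟩
    part parts (suc r) + r            ∎)
    where open ≤-Reasoning

  Shape-down : ∀ {r r′ c} → 1 ≤ r → r ≤ r′ → S (r′ , c) → S (r , c)
  Shape-down {r} {zero} r≥1 z≤n x∈ = x∈
  Shape-down {r} {suc r′} r≥1 r≤ x∈ with r ≟ suc r′
  ... | yes refl = x∈
  ... | no r≢ with r′ | ≤∧≢⇒< r≤ r≢
  ...   | zero  | s≤s r≤0 = ⊥-elim (<-irrefl refl (≤-trans r≥1 r≤0))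
  ...   | suc _ | s≤s r≤r′ = Shape-down r≥1 r≤r′ (Shape-below x∈)

  rowCells : ℕ → List Cell
  rowCells r = map (λ j → r , r + j) (upTo (part parts r))

  rows : List ℕ
  rows = map suc (downFrom (length parts))

  -- Built in the same way as `rw`, so that reading words of all tableaux are maps over one fixed
  -- list; `rcells` is the order of the flipped word.
  cells rcells : List Cell
  cells = concatMap rowCells rows
  rcells = reverse cells

  -- Needed because `flip` complements with respect to the length of the word.
  length-cells : length cells ≡ n
  length-cells = begin
    length cells                                         ≡⟨ length-concatMap rowCells rows ⟩
    sum (map (length ∘ rowCells) rows)                   ≡⟨ cong sum (map-∘ (downFrom (length parts))) ⟨
    sum (map (length ∘ rowCells ∘ suc) (downFrom (length parts)))
      ≡⟨ cong sum (map-cong length-row (downFrom (length parts))) ⟩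
    sum (map (part parts ∘ suc) (downFrom (length parts))) ≡⟨ sum-parts parts ⟩
    sum parts                                            ≡⟨ sum≡n ⟩
    n                                                    ∎
    where
    open ≡-Reasoning
    length-row : ∀ r → length (rowCells (suc r)) ≡ part parts (suc r)
    length-row r = trans (length-map _ (upTo (part parts (suc r)))) (length-upTo _)

  ∈-cells⁺ : ∀ {x} → S x → x ∈ˡ cells
  ∈-cells⁺ {suc r , c} x∈@((_ , p) , q , _) =
    ∈-concatMap⁺ rowCells (lose (∈-map⁺ suc (∈-downFrom⁺ p))
      (subst (λ c → (suc r , c) ∈ˡ rowCells (suc r)) (m+[n∸m]≡n q) (∈-map⁺ _ (∈-upTo⁺ j<))))
    where
    open ≤-Reasoning
    j< : c ∸ suc r < part parts (suc r)
    j< = +-cancelˡ-≤ r _ _ (begin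
      r + suc (c ∸ suc r) ≡⟨ +-suc r _ ⟩
      suc r + (c ∸ suc r) ≡⟨ m+[n∸m]≡n q ⟩
      c                   ≤⟨ Shape-bound x∈ ⟩
      part parts (suc r) + r ≡⟨ +-comm _ r ⟩
      r + part parts (suc r) ∎)

  ∈-cells⁻ : ∀ {x} → x ∈ˡ cells → S x
  ∈-cells⁻ x∈ with find (∈-concatMap⁻ rowCells {xs = rows} x∈)
  ... | _ , r∈ , x∈row with ∈-map⁻ suc r∈ | ∈-map⁻ _ x∈row
  ...   | r , r∈ , refl | j , j∈ , refl = Shape-intro (∈-downFrom⁻ r∈) (m≤m+n _ j) (begin
    suc r + j  ≡⟨ +-suc r j ⟨
    r + suc j  ≤⟨ +-monoʳ-≤ r (∈-upTo⁻ j∈) ⟩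
    r + part parts (suc r) ≡⟨ +-comm r _ ⟩
    part parts (suc r) + r ∎)
    where open ≤-Reasoning

  cells-sorted : AllPairs (λ x y → y ≺ x) cells
  cells-sorted = AllPairs.concat⁺ (All.map⁺ (All.tabulate λ {r} _ → row-sorted r))
    (AllPairs.map⁺ (AllPairs.map⁺ (AllPairs.applyDownFrom⁺₁ id (length parts) λ {i} {j} → rows-sorted i j)))
    where
    row-sorted : ∀ r → AllPairs (λ x y → y ≺ x) (rowCells r)
    row-sorted r = AllPairs.map⁺ (AllPairs.applyUpTo⁺₁ id (part parts r) λ i<j _ → inj₂ (refl , +-monoʳ-< r i<j))

    rows-sorted : ∀ i j → j < i → i < length parts →
                  All (λ x → All (_≺ x) (rowCells (suc j))) (rowCells (suc i))
    rows-sorted i j j<i _ = All.map⁺ (All.tabulate λ _ → All.map⁺ (All.tabulate λ _ → inj₁ (s≤s j<i)))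

  rcells-sorted : AllPairs _≺_ rcells
  rcells-sorted = AllPairs-reverse⁺ cells-sorted

  ∈-rcells⁺ : ∀ {x} → S x → x ∈ˡ rcells
  ∈-rcells⁺ = Any.reverse⁺ ∘ ∈-cells⁺

  ∈-rcells⁻ : ∀ {x} → x ∈ˡ rcells → S x
  ∈-rcells⁻ = ∈-cells⁻ ∘ Any.reverse⁻

  InjectiveOn : (Cell → ℕ) → Set
  InjectiveOn g = ∀ {x y} → S x → S y → g x ≡ g y → x ≡ y

  word : (Cell → ℕ) → Word
  word g = map g rcells

  word-pos-mono : ∀ {g} → InjectiveOn g → ∀ {x y} → S x → S y → x ≺ y → pos (g x) (word g) < pos (g y) (word g)
  word-pos-mono inj x∈ y∈ = pos-mono _ rcells-sorted ≺-asym
    (λ p q → inj (∈-rcells⁻ p) (∈-rcells⁻ q)) (∈-rcells⁺ x∈) (∈-rcells⁺ y∈)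

  word-pos-reflect : ∀ {g} → InjectiveOn g → ∀ {x y} → S x → S y → pos (g x) (word g) < pos (g y) (word g) → x ≺ y
  word-pos-reflect inj {x} {y} x∈ y∈ p with ≺-compare x y
  ... | inj₁ x≺y = x≺y
  ... | inj₂ (inj₁ refl) = ⊥-elim (<-irrefl refl p)
  ... | inj₂ (inj₂ y≺x) = ⊥-elim (<-asym p (word-pos-mono inj y∈ x∈ y≺x))

  word-cong : ∀ {g h} → (∀ {x} → S x → g x ≡ h x) → word g ≡ word h
  word-cong eq = map-cong-local (All.tabulate (eq ∘ ∈-rcells⁻))

  word-injective : ∀ {g h} → word g ≡ word h → ∀ {x} → S x → g x ≡ h x
  word-injective eq x∈ = map-≡⇒≗ rcells eq (∈-rcells⁺ x∈)

-- Tableaux, exchange of consecutive entries, and flipped reading words.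

rev : ℕ → ℕ → ℕ
rev n v = suc n ∸ v

module _ {n : ℕ} {μ : StrictPartition n} where
  open StrictPartition μ
  open SSYT

  private
    S = Shape μ

  e : SSYT μ → Cell → ℕ
  e T x = entry T (row x) (col x)

  module _ (T : SSYT μ) where

    e-mono : ∀ {x y} → S x → S y → x ⋖ y → e T x < e T y
    e-mono x∈ y∈ (inj₁ (refl , p)) = row-incr T x∈ y∈ p
    e-mono x∈ y∈ (inj₂ (refl , p)) = col-incr T x∈ y∈ p

    -- The path from `x` to `y` goes right first and then up, since columns reach down to row 1,
    -- whereas the other turning point `(r′ , c)` may lie left of the diagonal.
    e-mono-≤ : ∀ {x y} → S x → S y → row x ≤ row y → col x ≤ col y → e T x ≤ e T y
    e-mono-≤ {r , c} {r′ , c′} x∈ y∈ r≤ c≤ = ≤-trans rowwise columnwise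
      where
      corner∈ : S (r , c′)
      corner∈ = Shape-down μ (proj₁ (proj₁ x∈)) r≤ y∈
      rowwise : e T (r , c) ≤ e T (r , c′)
      rowwise with m≤n⇒m<n∨m≡n c≤
      ... | inj₁ c< = <⇒≤ (row-incr T x∈ corner∈ c<)
      ... | inj₂ refl = ≤-refl
      columnwise : e T (r , c′) ≤ e T (r′ , c′)
      columnwise with m≤n⇒m<n∨m≡n r≤
      ... | inj₁ r< = <⇒≤ (col-incr T corner∈ y∈ r<)
      ... | inj₂ refl = ≤-refl

    cellOf : ∀ {v} → 1 ≤ v → v ≤ n → ∃ λ x → S x × e T x ≡ v
    cellOf 1≤v v≤n with x , p , _ ← entry-once T _ 1≤v v≤n = x , p

    e-injective : InjectiveOn μ (e T)
    e-injective x∈ y∈ p with entry-range T y∈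
    ... | 1≤v , v≤n with _ , _ , unique ← entry-once T _ 1≤v v≤n =
      trans (sym (unique (x∈ , p))) (unique (y∈ , refl))

    -- The condition under which exchanging `a` and `suc a` leaves the filling standard.
    NoEdge : ℕ → Set
    NoEdge a = ∀ {x y} → S x → S y → x ⋖ y → e T x ≡ a → e T y ≢ suc a

    module _ {a} (1≤a : 1 ≤ a) (a<n : a < n) (noEdge : NoEdge a) where

      private
        σ = transp a (suc a)

        σ-range : ∀ {v} → 1 ≤ v × v ≤ n → 1 ≤ σ v × σ v ≤ n
        σ-range {v} v∈ with v ≟ a | v ≟ suc a
        ... | yes p | _ = subst (λ w → 1 ≤ w × w ≤ n) (sym (transp-left a _ p)) (s≤s z≤n , a<n)
        ... | no _ | yes q = subst (λ w → 1 ≤ w × w ≤ n) (sym (transp-right a (suc a) q)) (1≤a , <⇒≤ a<n)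
        ... | no p | no q = subst (λ w → 1 ≤ w × w ≤ n) (sym (transp-other a _ p q)) v∈

        σ-once : ∀ v → 1 ≤ v → v ≤ n → ∃! _≡_ λ x → x ∈ S × σ (e T x) ≡ v
        σ-once v 1≤v v≤n with σ-range (1≤v , v≤n)
        ... | 1≤σv , σv≤n with x , (x∈ , p) , unique ← entry-once T (σ v) 1≤σv σv≤n =
          x , (x∈ , trans (cong σ p) (transp-involutive a _ v)) ,
          λ (y∈ , q) → unique (y∈ , trans (sym (transp-involutive a _ _)) (cong σ q))

        σ-mono : ∀ {x y} → S x → S y → x ⋖ y → σ (e T x) < σ (e T y)
        σ-mono x∈ y∈ x⋖y = transp-suc-mono-< (e-mono x∈ y∈ x⋖y) λ (p , q) → noEdge x∈ y∈ x⋖y p q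

      swapEntries : SSYT μ
      swapEntries .entry r c = σ (entry T r c)
      swapEntries .entry-range x∈ = σ-range (entry-range T x∈)
      swapEntries .entry-once = σ-once
      swapEntries .row-incr x∈ y∈ p = σ-mono x∈ y∈ (inj₁ (refl , p))
      swapEntries .col-incr x∈ y∈ p = σ-mono x∈ y∈ (inj₂ (refl , p))

  e≤1+n : ∀ (T : SSYT μ) {x} → S x → e T x ≤ suc n
  e≤1+n T x∈ = m≤n⇒m≤1+n (proj₂ (entry-range T x∈))

  rev-injective : ∀ (T : SSYT μ) → InjectiveOn μ (rev n ∘ e T)
  rev-injective T x∈ y∈ p = e-injective T x∈ y∈ (∸-cancelˡ-≡ (e≤1+n T x∈) (e≤1+n T y∈) p)

  rw-cells : ∀ (T : SSYT μ) → rw T ≡ map (e T) (cells μ)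
  rw-cells T = sym (trans (map-concatMap (e T) (rowCells μ) (rows μ))
    (concatMap-cong (λ r → sym (map-∘ (upTo (part parts r)))) (rows μ)))

  -- Reversal acts on the cells and complementation on the entries; comparing positions in the
  -- flipped word thus becomes comparing cells by `_≺_`.
  flip-rw : ∀ (T : SSYT μ) → flip (rw T) ≡ word μ (rev n ∘ e T)
  flip-rw T = begin
    flip (rw T) ≡⟨ cong flip (rw-cells T) ⟩
    map (λ v → suc (length (map (e T) (cells μ))) ∸ v) (reverse (map (e T) (cells μ)))
      ≡⟨ cong₂ (λ m → map (λ v → suc m ∸ v)) (trans (length-map (e T) (cells μ)) (length-cells μ))
               (sym (reverse-map (e T) (cells μ))) ⟩
    map (rev n) (map (e T) (rcells μ)) ≡⟨ map-∘ (rcells μ) ⟨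
    word μ (rev n ∘ e T) ∎
    where open ≡-Reasoning

  flip-rw-transp : ∀ (T T′ : SSYT μ) {a b} → a ≤ n → b ≤ n → (∀ {x} → S x → e T′ x ≡ transp a b (e T x)) →
                   flip (rw T′) ≡ exchange (rev n a) (rev n b) (flip (rw T))
  flip-rw-transp T T′ {a} {b} a≤n b≤n eq = begin
    flip (rw T′)                                         ≡⟨ flip-rw T′ ⟩
    word μ (rev n ∘ e T′)
      ≡⟨ word-cong μ (λ x∈ → trans (cong (rev n) (eq x∈))
           (transp-∸ (m≤n⇒m≤1+n a≤n) (m≤n⇒m≤1+n b≤n) (e≤1+n T x∈))) ⟩
    word μ (transp (rev n a) (rev n b) ∘ rev n ∘ e T)          ≡⟨ map-∘ (rcells μ) ⟩
    exchange (rev n a) (rev n b) (word μ (rev n ∘ e T))        ≡⟨ cong (exchange (rev n a) (rev n b)) (flip-rw T) ⟨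
    exchange (rev n a) (rev n b) (flip (rw T))               ∎
    where open ≡-Reasoning

  -- Yields the uniqueness of the target of a move.
  flip-rw-injective : ∀ (T T′ : SSYT μ) → flip (rw T) ≡ flip (rw T′) → T ≈ T′
  flip-rw-injective T T′ p x∈ = ∸-cancelˡ-≡ (e≤1+n T x∈) (e≤1+n T′ x∈)
    (word-injective μ (trans (sym (flip-rw T)) (trans p (flip-rw T′))) x∈)

  rw-cong : ∀ (T T′ : SSYT μ) → T ≈ T′ → rw T ≡ rw T′
  rw-cong T T′ T≈T′ = trans (rw-cells T)
    (trans (map-cong-local (All.tabulate (λ x∈ → T≈T′ (∈-cells⁻ μ x∈)))) (sym (rw-cells T′)))

-- The operations `d` and `dᴿ` in terms of the order of cells.

d-first : ∀ i W → Between W i (pred i) (suc i) → d i W ≡ exchange i (suc i) W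
d-first i W p = if-yes (between? W i (pred i) (suc i)) p

d-second : ∀ i W → ¬ Between W i (pred i) (suc i) → Between W i (suc i) (pred i) →
           d i W ≡ exchange i (pred i) W
d-second i W ¬p q = trans (if-no (between? W i (pred i) (suc i)) ¬p) (if-yes (between? W i (suc i) (pred i)) q)

d-fixed : ∀ i W → ¬ Between W i (pred i) (suc i) → ¬ Between W i (suc i) (pred i) → d i W ≡ W
d-fixed i W ¬p ¬q = trans (if-no (between? W i (pred i) (suc i)) ¬p) (if-no (between? W i (suc i) (pred i)) ¬q)

dᴿ-restricted : ∀ i W → ID W (suc i) × ID (d i W) (suc i) → dᴿ i W ≡ W
dᴿ-restricted i W = if-yes ((ID? W ∩? ID? (d i W)) (suc i))

dᴿ-free : ∀ i W → ¬ (ID W (suc i) × ID (d i W) (suc i)) → dᴿ i W ≡ d i W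
dᴿ-free i W = if-no ((ID? W ∩? ID? (d i W)) (suc i))

CellBetween : Cell → Cell → Cell → Set
CellBetween x z y = (x ≺ z × z ≺ y) ⊎ (y ≺ z × z ≺ x)

-- Only one of three cells is the middle one. Hence the condition of the second branch of `d`
-- excludes that of the first.
CellBetween-exclusive : ∀ {x y z} → CellBetween x y z → ¬ CellBetween x z y
CellBetween-exclusive (inj₁ (p , q)) (inj₁ (r , s)) = ≺-asym q s
CellBetween-exclusive (inj₁ (p , q)) (inj₂ (r , s)) = ≺-asym p (≺-trans r s)
CellBetween-exclusive (inj₂ (p , q)) (inj₁ (r , s)) = ≺-asym q (≺-trans r s)
CellBetween-exclusive (inj₂ (p , q)) (inj₂ (r , s)) = ≺-asym p r

module _ {n : ℕ} (μ : StrictPartition n) {g} (inj : InjectiveOn μ g)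
         {x y z} (x∈ : Shape μ x) (y∈ : Shape μ y) (z∈ : Shape μ z) where

  between⁺ : ∀ {a b c} → g x ≡ a → g z ≡ b → g y ≡ c → CellBetween x z y → Between (word μ g) a b c
  between⁺ refl refl refl (inj₁ (p , q)) = inj₁ (word-pos-mono μ inj x∈ z∈ p , word-pos-mono μ inj z∈ y∈ q)
  between⁺ refl refl refl (inj₂ (p , q)) = inj₂ (word-pos-mono μ inj y∈ z∈ p , word-pos-mono μ inj z∈ x∈ q)

  between⁻ : ∀ {a b c} → g x ≡ a → g z ≡ b → g y ≡ c → Between (word μ g) a b c → CellBetween x z y
  between⁻ refl refl refl (inj₁ (p , q)) = inj₁ (word-pos-reflect μ inj x∈ z∈ p , word-pos-reflect μ inj z∈ y∈ q)
  between⁻ refl refl refl (inj₂ (p , q)) = inj₂ (word-pos-reflect μ inj y∈ z∈ p , word-pos-reflect μ inj z∈ x∈ q)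

module _ {n : ℕ} (μ : StrictPartition n) {g} (inj : InjectiveOn μ g)
         {x y i} (x∈ : Shape μ x) (y∈ : Shape μ y) (gx : g x ≡ i) (gy : g y ≡ suc i) where

  ID-word⁺ : 1 ≤ i → i < n → y ≺ x → ID (word μ g) i
  ID-word⁺ 1≤i i<n y≺x = (1≤i , subst (i <_) (sym lengthW) i<n) ,
    subst₂ (λ a b → pos a (word μ g) < pos b (word μ g)) gy gx (word-pos-mono μ inj y∈ x∈ y≺x)
    where
    lengthW : length (word μ g) ≡ n
    lengthW = trans (length-map g (rcells μ)) (trans (length-reverse (cells μ)) (length-cells μ))

  ID-word⁻ : ID (word μ g) i → y ≺ x
  ID-word⁻ (_ , p) = word-pos-reflect μ inj y∈ x∈
    (subst₂ (λ a b → pos a (word μ g) < pos b (word μ g)) (sym gy) (sym gx) p)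

-- Relative positions of three consecutive entries.

row-between : ∀ {x y z} → row x ≡ row y → x ≺ z → z ≺ y → row z ≡ row x × col z < col x × col y < col z
row-between refl (inj₁ p) (inj₁ q) = ⊥-elim (<-asym p q)
row-between refl (inj₁ p) (inj₂ (q , _)) = ⊥-elim (<-irrefl (sym q) p)
row-between refl (inj₂ (p , _)) (inj₁ q) = ⊥-elim (<-irrefl (sym p) q)
row-between refl (inj₂ (p , p′)) (inj₂ (_ , q′)) = sym p , p′ , q′

module _ {n : ℕ} {μ : StrictPartition n} (T : SSYT μ) {a : ℕ} where

  private
    S = Shape μ

    no-gap : ∀ {v w} → w ≡ suc v → ∀ {u} → v < u → ¬ u < w
    no-gap refl p q = <-irrefl refl (<-≤-trans p (≤-pred q))

    gap : ∀ {v} → a < v → v < suc (suc a) → v ≡ suc a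
    gap p q = ≤-antisym (≤-pred q) p

  -- If `x` and `y` share a row, `z` would lie in it to the left of `y`. If they share a column, `z`
  -- in a row strictly between would give an entry between `a` and `suc a`; in the row of `x` it
  -- would lie left of `x`; in the row of `y`, the cell in the row of `x` and the column of `z`
  -- would be a second cell with entry `suc a`.
  adjacent-¬between : ∀ {x y z} → S x → S y → S z → e T x ≡ a → e T y ≡ suc a → e T z ≡ suc (suc a) →
                      x ⋖ y → ¬ CellBetween x z y
  adjacent-¬between x∈ y∈ z∈ ex ey ez (inj₁ (p , q)) (inj₁ (r , s)) = ≺-asym (inj₂ (sym p , q)) (≺-trans r s)
  adjacent-¬between {x} {y} {z} x∈ y∈ z∈ ex ey ez (inj₁ (p , q)) (inj₂ (r , s))
    with row-between (sym p) r s
  ... | t , t′ , _ = <-asym (subst₂ _<_ ez ey (e-mono T z∈ y∈ (inj₁ (t , t′)))) (n<1+n _)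
  adjacent-¬between x∈ y∈ z∈ ex ey ez (inj₂ (p , q)) (inj₂ (r , s)) = ≺-asym (inj₁ q) (≺-trans r s)
  adjacent-¬between x∈ y∈ z∈ ex ey ez (inj₂ (refl , q)) (inj₁ (inj₁ r , inj₁ s)) =
    no-gap (trans ey (cong suc (sym ex))) (e-mono T x∈ w∈ (inj₂ (refl , r))) (e-mono T w∈ y∈ (inj₂ (refl , s)))
    where w∈ = Shape-down μ (proj₁ (proj₁ z∈)) (<⇒≤ s) y∈
  adjacent-¬between x∈ y∈ z∈ ex ey ez (inj₂ (refl , q)) (inj₁ (inj₂ (refl , r) , _)) =
    <-asym (subst₂ _<_ ez ex (e-mono T z∈ x∈ (inj₁ (refl , r)))) (m<n⇒m<1+n (n<1+n _))
  adjacent-¬between x∈ y∈ z∈ ex ey ez (inj₂ (refl , q)) (inj₁ (inj₁ r , inj₂ (refl , s))) =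
    <-irrefl (cong row (e-injective T w∈ y∈ (trans (gap (subst (_< _) ex (e-mono T x∈ w∈ (inj₁ (refl , s))))
      (subst (e T _ <_) ez (e-mono T w∈ z∈ (inj₂ (refl , q))))) (sym ey)))) q
    where w∈ = Shape-down μ (proj₁ (proj₁ x∈)) (<⇒≤ q) z∈

  -- The surviving case has `x` directly below `y` and `z` to the left of `x`. A cell in the row of
  -- `y` and the column of `z` would be a second one with entry `suc a`, so that place is left of
  -- the diagonal, and `z` itself is on it.
  adjacent-between⇒diagonal : ∀ {x y z} → S x → S y → S z → e T z ≡ a → e T x ≡ suc a → e T y ≡ suc (suc a) →
                              x ⋖ y → CellBetween x z y → row z ≡ col z
  adjacent-between⇒diagonal x∈ y∈ z∈ ez ex ey (inj₁ (p , q)) (inj₁ (r , s)) =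
    ⊥-elim (≺-asym (inj₂ (sym p , q)) (≺-trans r s))
  adjacent-between⇒diagonal x∈ y∈ z∈ ez ex ey (inj₁ (p , q)) (inj₂ (r , s)) with row-between (sym p) r s
  ... | t , _ , t′ = ⊥-elim (<-asym (subst₂ _<_ ex ez (e-mono T x∈ z∈ (inj₁ (trans p (sym t) , t′)))) (n<1+n _))
  adjacent-between⇒diagonal x∈ y∈ z∈ ez ex ey (inj₂ (p , q)) (inj₂ (r , s)) = ⊥-elim (≺-asym (inj₁ q) (≺-trans r s))
  adjacent-between⇒diagonal x∈ y∈ z∈ ez ex ey (inj₂ (refl , q)) (inj₁ (inj₁ r , inj₁ s)) =
    ⊥-elim (no-gap (trans ey (cong suc (sym ex)))
      (e-mono T x∈ w∈ (inj₂ (refl , r))) (e-mono T w∈ y∈ (inj₂ (refl , s))))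
    where w∈ = Shape-down μ (proj₁ (proj₁ z∈)) (<⇒≤ s) y∈
  adjacent-between⇒diagonal x∈ y∈ z∈ ez ex ey (inj₂ (refl , q)) (inj₁ (inj₁ r , inj₂ (refl , s))) =
    ⊥-elim (<-asym (subst₂ _<_ ey ez (e-mono T y∈ z∈ (inj₁ (refl , s)))) (m<n⇒m<1+n (n<1+n _)))
  adjacent-between⇒diagonal {r , c} {r′ , _} {_ , c′} x∈ y∈ z∈ ez ex ey (inj₂ (refl , q)) (inj₁ (inj₂ (refl , s) , _))
    with r′ ≤? c′ | suc r <? r′
  ... | yes r′≤c′ | _ =
    ⊥-elim (<-irrefl (sym (cong row (e-injective T w∈ x∈ (trans (gap (subst (_< _) ez (e-mono T z∈ w∈ (inj₂ (refl , q))))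
      (subst (e T _ <_) ey (e-mono T w∈ y∈ (inj₁ (refl , s))))) (sym ex))))) q)
    where w∈ = Shape-left μ y∈ r′≤c′ (<⇒≤ s)
  ... | no _ | yes 1+r<r′ =
    ⊥-elim (no-gap (trans ey (cong suc (sym ex)))
      (e-mono T x∈ w∈ (inj₂ (refl , n<1+n r))) (e-mono T w∈ y∈ (inj₂ (refl , 1+r<r′))))
    where w∈ = Shape-down μ (s≤s z≤n) q y∈
  ... | no r′≰c′ | no 1+r≮r′ = ≤-antisym (proj₁ (proj₂ z∈)) (≤-pred (≤-trans (≰⇒> r′≰c′) (≮⇒≥ 1+r≮r′)))

  -- Every cell weakly above a diagonal cell is also weakly to its right, so its entry cannot be
  -- smaller.
  diagonal-≺ : ∀ {x y} → S x → S y → e T x < e T y → row y ≡ col y → x ≺ y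
  diagonal-≺ {x} {y} x∈ y∈ ex<ey diag with row x <? row y
  ... | yes p = inj₁ p
  ... | no p = ⊥-elim (<⇒≱ ex<ey (e-mono-≤ T y∈ x∈ (≮⇒≥ p)
    (≤-trans (≤-reflexive (sym diag)) (≤-trans (≮⇒≥ p) (proj₁ (proj₂ x∈))))))

-- Existence and uniqueness of a move.

module Step {n : ℕ} {μ : StrictPartition n} (T : SSYT μ) {i a : ℕ}
            (i+a≡n : i + a ≡ n) (2≤i : 2 ≤ i) (2≤a : 2 ≤ a) where

  private
    S = Shape μ
    W = flip (rw T)
    g = rev n ∘ e T

    -- The bounds on `i` and `a` keep the entries `pred a`, ..., `2 + a` between 1 and `n`.
    2+a≤n : 2 + a ≤ n
    2+a≤n = ≤-trans (+-monoˡ-≤ a 2≤i) (≤-reflexive i+a≡n)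

    1+i<n : suc i < n
    1+i<n = ≤-trans (+-monoˡ-≤ i 2≤a) (≤-reflexive (trans (+-comm a i) i+a≡n))

    rev-eq : ∀ {v w} → v + w ≡ suc n → rev n v ≡ w
    rev-eq {v} {w} p = trans (cong (_∸ v) (sym p)) (m+n∸m≡n v w)

    suc-pred-≥ : ∀ {m} → 2 ≤ m → suc (pred m) ≡ m
    suc-pred-≥ (s≤s _) = refl

    1+pred-i : suc (pred i) ≡ i
    1+pred-i = suc-pred-≥ 2≤i

    1+pred-a : suc (pred a) ≡ a
    1+pred-a = suc-pred-≥ 2≤a

    rev₂ : rev n (2 + a) ≡ pred i
    rev₂ = rev-eq (cong suc (trans (sym (+-suc a (pred i))) (trans (cong (a +_) 1+pred-i) (trans (+-comm a i) i+a≡n))))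

    rev₁ : rev n (suc a) ≡ i
    rev₁ = rev-eq (cong suc (trans (+-comm a i) i+a≡n))

    rev₀ : rev n a ≡ suc i
    rev₀ = rev-eq (trans (+-suc a i) (cong suc (trans (+-comm a i) i+a≡n)))

    rev₋ : rev n (pred a) ≡ suc (suc i)
    rev₋ = rev-eq (trans (+-suc (pred a) (suc i)) (trans (cong (_+ suc i) 1+pred-a)
      (trans (+-suc a i) (cong suc (trans (+-comm a i) i+a≡n)))))

    inj : InjectiveOn μ g
    inj = rev-injective T

  -- cₖ is the cell of a + k and c₋ that of a ∸ 1; in the flipped word they carry i + 1 ∸ k and i + 2.
  module Cells {c₂ c₁ c₀ c₋} (c₂∈ : S c₂) (c₁∈ : S c₁) (c₀∈ : S c₀) (c₋∈ : S c₋)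
    (e₂ : e T c₂ ≡ 2 + a) (e₁ : e T c₁ ≡ suc a) (e₀ : e T c₀ ≡ a) (e₋ : e T c₋ ≡ pred a) where

    private
      g₂ = trans (cong (rev n) e₂) rev₂
      g₁ = trans (cong (rev n) e₁) rev₁
      g₀ = trans (cong (rev n) e₀) rev₀
      g₋ = trans (cong (rev n) e₋) rev₋

    W-between⁻₁ : Between W i (pred i) (suc i) → CellBetween c₁ c₂ c₀
    W-between⁻₁ p = between⁻ μ inj c₁∈ c₀∈ c₂∈ g₁ g₂ g₀ (subst (λ W → Between W i (pred i) (suc i)) (flip-rw T) p)

    W-between⁻₂ : Between W i (suc i) (pred i) → CellBetween c₁ c₀ c₂
    W-between⁻₂ p = between⁻ μ inj c₁∈ c₂∈ c₀∈ g₁ g₀ g₂ (subst (λ W → Between W i (suc i) (pred i)) (flip-rw T) p)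

    W-between⁺₂ : CellBetween c₁ c₀ c₂ → Between W i (suc i) (pred i)
    W-between⁺₂ p = subst (λ W → Between W i (suc i) (pred i)) (sym (flip-rw T)) (between⁺ μ inj c₁∈ c₂∈ c₀∈ g₁ g₀ g₂ p)

    W-ID⁻ : ID W (suc i) → c₋ ≺ c₀
    W-ID⁻ p = ID-word⁻ μ inj c₀∈ c₋∈ g₀ g₋ (subst (λ W → ID W (suc i)) (flip-rw T) p)

    W-ID⁺ : c₋ ≺ c₀ → ID W (suc i)
    W-ID⁺ p = subst (λ W → ID W (suc i)) (sym (flip-rw T)) (ID-word⁺ μ inj c₀∈ c₋∈ g₀ g₋ (s≤s z≤n) 1+i<n p)

    -- The exchanged values are `i` and `pred i`, so `suc i` and `suc (suc i)` keep their positions.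
    exchange-ID⁺ : c₋ ≺ c₀ → ID (exchange i (pred i) W) (suc i)
    exchange-ID⁺ p = subst (λ W → ID W (suc i)) (sym exchangeW)
      (ID-word⁺ μ (λ x∈ y∈ q → inj x∈ y∈ (transp-injective i (pred i) q)) c₀∈ c₋∈
        (fixed g₀ (<⇒≢ (n<1+n i)) (s≤s (pred[n]≤n))) (fixed g₋ (<⇒≢ (m<n⇒m<1+n (n<1+n i))) (s≤s (m≤n⇒m≤1+n pred[n]≤n)))
        (s≤s z≤n) 1+i<n p)
      where
      exchangeW : exchange i (pred i) W ≡ word μ (transp i (pred i) ∘ g)
      exchangeW = trans (cong (exchange i (pred i)) (flip-rw T)) (sym (map-∘ (rcells μ)))
      fixed : ∀ {v w} → v ≡ w → i ≢ w → pred i < w → transp i (pred i) v ≡ w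
      fixed refl i≢ pred< = transp-other i (pred i) (i≢ ∘ sym) (<⇒≢ pred< ∘ sym)

    -- In this branch `c₂` is read between `c₀` and `c₁`, which `adjacent-¬between` forbids for
    -- cells in a common row or column.
    noEdge₀ : Between W i (pred i) (suc i) → NoEdge T a
    noEdge₀ p x∈ y∈ x⋖y ex ey
      with refl ← e-injective T x∈ c₀∈ (trans ex (sym e₀)) | refl ← e-injective T y∈ c₁∈ (trans ey (sym e₁)) =
      adjacent-¬between T c₀∈ c₁∈ c₂∈ e₀ e₁ e₂ x⋖y (swap (W-between⁻₁ p))

    -- The only obstruction is the diagonal cell c₀ = (r , r) with c₁ = (r , r + 1), c₂ = (r + 1 , r + 1);
    -- then c₋ lies in a lower row, so the restriction turns the move into the identity.
    noEdge₁ : ¬ Between W i (pred i) (suc i) → Between W i (suc i) (pred i) →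
              ¬ (ID W (suc i) × ID (d i W) (suc i)) → NoEdge T (suc a)
    noEdge₁ ¬p q free x∈ y∈ x⋖y ex ey
      with refl ← e-injective T x∈ c₁∈ (trans ex (sym e₁)) | refl ← e-injective T y∈ c₂∈ (trans ey (sym e₂)) =
      free (W-ID⁺ c₋≺c₀ , subst (λ W → ID W (suc i)) (sym (d-second i W ¬p q)) (exchange-ID⁺ c₋≺c₀))
      where
      c₋≺c₀ : c₋ ≺ c₀
      c₋≺c₀ = diagonal-≺ T {a} c₋∈ c₀∈ (≤-reflexive (trans (cong suc e₋) (trans 1+pred-a (sym e₀))))
        (adjacent-between⇒diagonal T c₁∈ c₂∈ c₀∈ e₀ e₁ e₂ x⋖y (W-between⁻₂ q))

    -- For transitivity. Since `c₀` is read before `c₋`, `suc i` is not in `ID W` and the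
    -- restriction is not triggered.
    moves-swap : ∀ (T′ : SSYT μ) → (∀ {x} → S x → e T′ x ≡ transp (suc a) (2 + a) (e T x)) →
                 CellBetween c₁ c₀ c₂ → c₀ ≺ c₋ → Moves i T T′
    moves-swap T′ eq btw c₀≺c₋ = begin
      flip (rw T′)                                   ≡⟨ flip-rw-transp T T′ (<⇒≤ 2+a≤n) 2+a≤n eq ⟩
      exchange (rev n (suc a)) (rev n (2 + a)) W         ≡⟨ cong₂ (λ a b → exchange a b W) rev₁ rev₂ ⟩
      exchange i (pred i) W
        ≡⟨ d-second i W (CellBetween-exclusive btw ∘ W-between⁻₁) (W-between⁺₂ btw) ⟨
      d i W                                          ≡⟨ dᴿ-free i W (λ (p , _) → ≺-asym c₀≺c₋ (W-ID⁻ p)) ⟨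
      dᴿ i W                                         ∎
      where open ≡-Reasoning

    move-exists : ∃ λ T′ → Moves i T T′
    move-exists with (ID? W ∩? ID? (d i W)) (suc i) | between? W i (pred i) (suc i) | between? W i (suc i) (pred i)
    ... | yes restricted | _ | _ = T , sym (dᴿ-restricted i W restricted)
    ... | no free | no ¬p | no ¬q = T , sym (trans (dᴿ-free i W free) (d-fixed i W ¬p ¬q))
    ... | no free | yes p | _ = T′ , (begin
      flip (rw T′)
        ≡⟨ flip-rw-transp T T′ (<⇒≤ 2+a≤n) (<⇒≤ (<⇒≤ 2+a≤n)) (λ {x} _ → transp-comm a (suc a) (e T x)) ⟩
      exchange (rev n (suc a)) (rev n a) W          ≡⟨ cong₂ (λ a b → exchange a b W) rev₁ rev₀ ⟩
      exchange i (suc i) W                      ≡⟨ d-first i W p ⟨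
      d i W                                     ≡⟨ dᴿ-free i W free ⟨
      dᴿ i W                                    ∎)
      where
      open ≡-Reasoning
      T′ = swapEntries T (<⇒≤ 2≤a) (<⇒≤ 2+a≤n) (noEdge₀ p)
    ... | no free | no ¬p | yes q = T′ , (begin
      flip (rw T′)                              ≡⟨ flip-rw-transp T T′ (<⇒≤ 2+a≤n) 2+a≤n (λ _ → refl) ⟩
      exchange (rev n (suc a)) (rev n (2 + a)) W    ≡⟨ cong₂ (λ a b → exchange a b W) rev₁ rev₂ ⟩
      exchange i (pred i) W                     ≡⟨ d-second i W ¬p q ⟨
      d i W                                     ≡⟨ dᴿ-free i W free ⟨
      dᴿ i W                                    ∎)
      where
      open ≡-Reasoning
      T′ = swapEntries T (s≤s z≤n) 2+a≤n (noEdge₁ ¬p q free)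

  moves-∃! : ∃! _≈_ λ T′ → Moves i T T′
  moves-∃! with cellOf T (s≤s z≤n) 2+a≤n | cellOf T (s≤s z≤n) (<⇒≤ 2+a≤n) | cellOf T (<⇒≤ 2≤a) (<⇒≤ (<⇒≤ 2+a≤n))
              | cellOf T (≤-pred (≤-trans 2≤a (≤-reflexive (sym 1+pred-a)))) (≤-trans pred[n]≤n (<⇒≤ (<⇒≤ 2+a≤n)))
  ... | c₂ , c₂∈ , e₂ | c₁ , c₁∈ , e₁ | c₀ , c₀∈ , e₀ | c₋ , c₋∈ , e₋ =
    let T′ , p = Cells.move-exists c₂∈ c₁∈ c₀∈ c₋∈ e₂ e₁ e₀ e₋
    in T′ , p , λ {T″} q → flip-rw-injective T′ T″ (trans p (sym q))

-- Corners, promotion, and preparation of the smaller entries.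

module _ {n : ℕ} {μ : StrictPartition n} where
  open StrictPartition μ
  open SSYT

  private
    S = Shape μ

  Shape? : ∀ x → Dec (S x)
  Shape? (r , c) = (1 ≤? r ×-dec r ≤? length parts) ×-dec (r ≤? c ×-dec c ≤? part parts r + r ∸ 1)

  -- When `e T x ≤ k`, `x` is a removable corner of the subtableau of entries at most `k`.
  Corner : SSYT μ → ℕ → Cell → Set
  Corner T k x = ∀ {y} → S y → x ⋖ y → k < e T y

  module _ (T : SSYT μ) (k : ℕ) where

    -- The two neighbours suffice: any farther cell of the row or column forces the neighbour into
    -- the shape and has an entry at least as large.
    corner-local : ∀ {r c} → S (r , c) → ¬ (S (r , suc c) × e T (r , suc c) ≤ k) →
                   ¬ (S (suc r , c) × e T (suc r , c) ≤ k) → Corner T k (r , c)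
    corner-local x∈ ¬right ¬above y∈ (inj₁ (refl , c<)) = ≰⇒> λ ey≤k →
      let w∈ = Shape-left μ y∈ (≤-trans (proj₁ (proj₂ x∈)) (n≤1+n _)) c<
      in ¬right (w∈ , ≤-trans (e-mono-≤ T w∈ y∈ ≤-refl c<) ey≤k)
    corner-local x∈ ¬right ¬above y∈ (inj₂ (refl , r<)) = ≰⇒> λ ey≤k →
      let w∈ = Shape-down μ (s≤s z≤n) r< y∈
      in ¬above (w∈ , ≤-trans (e-mono-≤ T w∈ y∈ r< ≤-refl) ey≤k)

    CornerAbove : Cell → Set
    CornerAbove x = ∃ λ y → S y × row x ≤ row y × col x ≤ col y × e T y ≤ k × Corner T k y

    -- Walk right or up while the entry stays at most `k`. Each step increases the entry, so `fuel`
    -- bounds the remaining steps.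
    corner-above : ∀ fuel {x} → S x → e T x ≤ k → k ≤ e T x + fuel → CornerAbove x
    corner-above zero {x} x∈ ex≤k k≤ex = x , x∈ , ≤-refl , ≤-refl , ex≤k ,
      λ y∈ x⋖y → ≤-<-trans (≤-trans k≤ex (≤-reflexive (+-identityʳ _))) (e-mono T x∈ y∈ x⋖y)
    corner-above (suc fuel) {r , c} x∈ ex≤k k≤
      with Shape? (r , suc c) ×-dec e T (r , suc c) ≤? k | Shape? (suc r , c) ×-dec e T (suc r , c) ≤? k
    ... | no ¬right | no ¬above = (r , c) , x∈ , ≤-refl , ≤-refl , ex≤k , corner-local x∈ ¬right ¬above
    ... | yes (y∈ , ey≤k) | _ =
      let z , z∈ , r≤ , c≤ , rest = corner-above fuel y∈ ey≤k (≤-trans k≤ (≤-trans (≤-reflexive (+-suc _ fuel))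
            (+-monoˡ-≤ fuel (e-mono T x∈ y∈ (inj₁ (refl , n<1+n c))))))
      in z , z∈ , r≤ , <⇒≤ c≤ , rest
    ... | no _ | yes (y∈ , ey≤k) =
      let z , z∈ , r≤ , c≤ , rest = corner-above fuel y∈ ey≤k (≤-trans k≤ (≤-trans (≤-reflexive (+-suc _ fuel))
            (+-monoˡ-≤ fuel (e-mono T x∈ y∈ (inj₂ (refl , n<1+n r))))))
      in z , z∈ , <⇒≤ r≤ , c≤ , rest

    corner-exists : ∀ {x} → S x → e T x ≤ k → CornerAbove x
    corner-exists x∈ ex≤k = corner-above k x∈ ex≤k (m≤n+m k _)

  AgreeAbove : ℕ → SSYT μ → SSYT μ → Set
  AgreeAbove m T U = ∀ {y} → S y → m < e T y → e U y ≡ e T y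

  module _ {T U : SSYT μ} where

    agree-trans : ∀ {m V} → AgreeAbove m T U → AgreeAbove m U V → AgreeAbove m T V
    agree-trans TU UV y∈ m< = trans (UV y∈ (subst (_ <_) (sym (TU y∈ m<)) m<)) (TU y∈ m<)

    -- `AgreeAbove` bounds only the entries of its first tableau. A value of `U` above `m` occurs in
    -- `T` at some `z`, hence in `U` at `z` too, and injectivity of `U` identifies `z`.
    agree-sym : ∀ {m} → AgreeAbove m T U → AgreeAbove m U T
    agree-sym TU {y} y∈ m< with entry-range U y∈
    ... | 1≤v , v≤n with z , z∈ , p ← cellOf T 1≤v v≤n =
      trans (cong (e T) (sym z≡y)) p
      where
      z≡y : z ≡ y
      z≡y = e-injective U z∈ y∈ (trans (TU z∈ (subst (_ <_) (sym p) m<)) p)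

    agree-weaken : ∀ {m m′} → m ≤ m′ → AgreeAbove m T U → AgreeAbove m′ T U
    agree-weaken m≤m′ TU y∈ m′< = TU y∈ (≤-<-trans m≤m′ m′<)

  -- The entry of a corner is raised to m by exchanging it repeatedly with its successor.
  promote : ∀ fuel {m} (T : SSYT μ) {x} → m ≤ n → S x → e T x + fuel ≡ m → Corner T m x →
            ∃ λ U → e U x ≡ m × AgreeAbove m T U
  promote zero T m≤n x∈ p corner = T , trans (sym (+-identityʳ _)) p , λ _ _ → refl
  promote (suc fuel) {m} T {x} m≤n x∈ p corner =
    let U , q , agree = promote fuel T₁ m≤n x∈ p₁
          (λ y∈ x⋖y → subst (m <_) (sym (T₁-agree y∈ (corner y∈ x⋖y))) (corner y∈ x⋖y))
    in U , q , agree-trans {T} {T₁} {V = U} T₁-agree agree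
    where
    a = e T x
    1+a+fuel : suc a + fuel ≡ m
    1+a+fuel = trans (sym (+-suc a fuel)) p
    a<m : a < m
    a<m = ≤-trans (m≤m+n (suc a) fuel) (≤-reflexive 1+a+fuel)
    noEdge : NoEdge T a
    noEdge y∈ z∈ y⋖z ey ez with refl ← e-injective T y∈ x∈ ey =
      <⇒≱ (corner z∈ y⋖z) (subst (_≤ m) (sym ez) a<m)
    T₁ = swapEntries T (proj₁ (entry-range T x∈)) (≤-trans a<m m≤n) noEdge
    T₁-agree : AgreeAbove m T T₁
    T₁-agree y∈ m<ey = transp-other a (suc a) (<⇒≢ (<-trans a<m m<ey) ∘ sym) (<⇒≢ (≤-<-trans a<m m<ey) ∘ sym)
    p₁ : e T₁ x + fuel ≡ m
    p₁ = trans (cong (_+ fuel) (transp-left a (suc a) {a} refl)) 1+a+fuel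

  promote-corner : ∀ {m} (T : SSYT μ) {x} → m ≤ n → S x → e T x ≤ m → Corner T m x →
                   ∃ λ U → e U x ≡ m × AgreeAbove m T U
  promote-corner T m≤n x∈ ex≤m = promote _ T m≤n x∈ (m+[n∸m]≡n ex≤m)

  -- p and q are the cells of k + 1 and k + 2, in either order.
  module _ {k : ℕ} (T : SSYT μ) (k≤n : k ≤ n) {p q : Cell} (p∈ : S p) (q∈ : S q) (q<p : row q < row p)
           (k<ep : k < e T p) (ep≤2+k : e T p ≤ 2 + k) (k<eq : k < e T q) (q-corner : Corner T (2 + k) q)
           (p-or-q : ∀ {y} → S y → k < e T y → e T y ≤ 2 + k → y ≡ p ⊎ y ≡ q) where

    -- `x` and `y` will serve as `c₀` and `c₋` in `moves-swap`: `x` is read between `q` and `p` to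
    -- select the second branch of `d`, and before `y` to avoid the restriction.
    Witness : Set
    Witness = ∃ λ U → AgreeAbove k T U × ∃ λ x → ∃ λ y → S x × S y × e U x ≡ k × suc (e U y) ≡ k ×
              q ≺ x × x ≺ p × x ≺ y

    -- x is a corner in the row just below p, and y one weakly above and to the right of the left neighbour of x.
    between-corners : Witness
    between-corners = build (row p) refl
      where
      build : ∀ r → r ≡ row p → Witness
      build zero r≡ = ⊥-elim (<-irrefl refl (≤-trans (≤-trans (s≤s z≤n) q<p) (≤-reflexive (sym r≡))))
      build (suc zero) r≡ = ⊥-elim (<-irrefl refl (≤-trans (proj₁ (proj₁ q∈)) (≤-pred (≤-trans q<p (≤-reflexive (sym r≡))))))
      build (suc (suc r)) refl with corner-exists T k x₀∈ x₀≤k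
        where
        x₀ : Cell
        x₀ = suc r , col p
        x₀∈ : S x₀
        x₀∈ = Shape-below μ p∈
        x₀⋖p : x₀ ⋖ p
        x₀⋖p = inj₂ (refl , n<1+n _)
        -- With an entry above `k`, this cell would have to be `q`, and `p` directly above it would
        -- contradict `q-corner`.
        x₀≤k : e T x₀ ≤ k
        x₀≤k with e T x₀ ≤? k
        ... | yes x₀≤k = x₀≤k
        ... | no x₀≰k with p-or-q x₀∈ (≰⇒> x₀≰k) (≤-trans (<⇒≤ (e-mono T x₀∈ p∈ x₀⋖p)) ep≤2+k)
        ...   | inj₁ x₀≡p = ⊥-elim (<⇒≢ (n<1+n _) (cong row x₀≡p))
        ...   | inj₂ x₀≡q = ⊥-elim (<⇒≱ (q-corner p∈ (subst (_⋖ p) x₀≡q x₀⋖p)) ep≤2+k)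
      ... | (rx , zero) , _ , _ , c≤ , _ = ⊥-elim (<⇒≱ (≤-trans (s≤s z≤n) (proj₁ (proj₂ p∈))) c≤)
      ... | x@(rx , suc cx) , x∈ , r≤ , c≤ , x≤k , x-corner
        -- The corner cannot leave the row below `p`: otherwise it would be weakly above and to the
        -- right of `p`, whose entry exceeds `k`.
        with ≤-antisym r≤ (≤-pred (≰⇒> λ p≤x → <⇒≱ k<ep (≤-trans (e-mono-≤ T p∈ x∈ p≤x c≤) x≤k)))
      ...   | refl with promote-corner T k≤n x∈ x≤k x-corner
      ...     | U₁ , ex , TU₁ = build′ k refl
        where
        -- The left neighbour exists: `x` is weakly to the right of `p` and one row lower, so it is
        -- off the diagonal.
        w : Cell
        w = suc r , cx
        w∈ : S w
        w∈ = Shape-left μ x∈ (≤-pred (≤-trans (proj₁ (proj₂ p∈)) c≤)) (n≤1+n cx)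
        w<k : e U₁ w < k
        w<k = <-≤-trans (e-mono U₁ w∈ x∈ (inj₁ (refl , n<1+n cx))) (≤-reflexive ex)
        -- If `q` is in the row of `x`, its entry above `k` places it to the right, hence earlier in
        -- the reading.
        q≺x : q ≺ x
        q≺x with m≤n⇒m<n∨m≡n (≤-pred q<p)
        ... | inj₁ lt = inj₁ lt
        ... | inj₂ eq = inj₂ (eq , ≰⇒> λ c≤′ → <⇒≱ k<eq (≤-trans (e-mono-≤ T q∈ x∈ (≤-reflexive eq) c≤′) x≤k))
        build′ : ∀ k₀ → k₀ ≡ k → Witness
        build′ zero refl = ⊥-elim (<⇒≱ w<k z≤n)
        build′ (suc k′) refl with corner-exists U₁ k′ w∈ (≤-pred w<k)
        ... | y , y∈ , ry≥ , _ , y≤k′ , y-corner with promote-corner U₁ (<⇒≤ k≤n) y∈ y≤k′ y-corner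
        ...   | U , ey , U₁U = U , agree-trans {T} {U₁} {V = U} TU₁ (agree-weaken {U₁} {U} (n≤1+n k′) U₁U) ,
          x , y , x∈ , y∈ ,
          trans (U₁U x∈ (≤-reflexive (sym ex))) ex , cong suc ey , q≺x , inj₁ (n<1+n _) , x≺y
          where
          -- If `y` is in the row of `x`, its entry below `k` places it to the left, hence later in
          -- the reading.
          x≺y : x ≺ y
          x≺y with m≤n⇒m<n∨m≡n ry≥
          ... | inj₁ lt = inj₁ lt
          ... | inj₂ eq = inj₂ (eq , ≰⇒> λ c≤′ → <⇒≱ (s≤s y≤k′)
            (≤-trans (≤-reflexive (sym ex)) (e-mono-≤ U₁ x∈ y∈ (≤-reflexive eq) c≤′)))

  -- Exchange of the two largest differing entries.

  module SwitchLemmas {k : ℕ} (T : SSYT μ) {x y} (2+k≤n : 2 + k ≤ n) (x∈ : S x) (y∈ : S y)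
                      (ex : e T x ≡ 2 + k) (ey : e T y ≡ suc k) (y-corner : Corner T (2 + k) y) where

    k<ex : k < e T x
    k<ex = ≤-trans (n≤1+n _) (≤-reflexive (sym ex))

    ex≤ : e T x ≤ 2 + k
    ex≤ = ≤-reflexive ex

    k<ey : k < e T y
    k<ey = ≤-reflexive (sym ey)

    ey≤ : e T y ≤ 2 + k
    ey≤ = ≤-trans (≤-reflexive ey) (n≤1+n _)

    x-or-y : ∀ {z} → S z → k < e T z → e T z ≤ 2 + k → z ≡ x ⊎ z ≡ y
    x-or-y z∈ lt le with m≤n⇒m<n∨m≡n le
    ... | inj₁ lt′ = inj₂ (e-injective T z∈ y∈ (trans (≤-antisym (≤-pred lt′) lt) (sym ey)))
    ... | inj₂ eq = inj₁ (e-injective T z∈ x∈ (trans eq (sym ex)))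

    -- Applies `moves-swap` with `a = k` and `i = n ∸ k`, where `x`, `y`, `z`, `w` are `c₂`, `c₁`,
    -- `c₀`, `c₋`. The entry of `w` is positive, which gives `2 ≤ k`.
    finish : ∀ U → AgreeAbove k T U → ∀ {z w} → S z → S w → e U z ≡ k → suc (e U w) ≡ k →
             CellBetween y z x → z ≺ w →
             ∃ λ U → ∃ λ V → AgreeAbove k T U × Move U V × AgreeAbove (2 + k) T V × e V y ≡ 2 + k
    finish U TU {z} {w} z∈ w∈ ez ew btw z≺w =
      U , V , TU , (n ∸ k , 2≤i , i+2≤n , moves) ,
      agree-trans {T} {U} {V = V} (agree-weaken {T} {U} (≤-trans (n≤1+n k) (n≤1+n _)) TU) UV ,
      transp-left (suc k) (2 + k) e′y
      where
      e′x : e U x ≡ 2 + k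
      e′x = trans (TU x∈ k<ex) ex
      e′y : e U y ≡ suc k
      e′y = trans (TU y∈ k<ey) ey
      noEdge : NoEdge U (suc k)
      noEdge p∈ q∈ p⋖q ep eq
        with refl ← e-injective U p∈ y∈ (trans ep (sym e′y)) | refl ← e-injective U q∈ x∈ (trans eq (sym e′x)) =
        <⇒≱ (y-corner x∈ p⋖q) ex≤
      V : SSYT μ
      V = swapEntries U (s≤s z≤n) 2+k≤n noEdge
      UV : AgreeAbove (2 + k) U V
      UV _ lt = transp-other (suc k) (2 + k) (<⇒≢ (<-trans (n<1+n _) lt) ∘ sym) (<⇒≢ lt ∘ sym)
      2≤k : 2 ≤ k
      2≤k = ≤-trans (s≤s (proj₁ (entry-range U w∈))) (≤-reflexive ew)
      i+k≡n : n ∸ k + k ≡ n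
      i+k≡n = m∸n+n≡m (<⇒≤ (<⇒≤ 2+k≤n))
      2≤i : 2 ≤ n ∸ k
      2≤i = m+n≤o⇒m≤o∸n 2 2+k≤n
      i+2≤n : n ∸ k + 2 ≤ n
      i+2≤n = ≤-trans (+-monoʳ-≤ (n ∸ k) 2≤k) (≤-reflexive i+k≡n)
      moves : Moves (n ∸ k) U V
      moves = Step.Cells.moves-swap U i+k≡n 2≤i 2≤k x∈ y∈ z∈ w∈ e′x e′y ez (cong pred ew) V (λ _ → refl) btw z≺w

  -- Two corners cannot share a row; the higher one plays `p` and the lower one `q` in
  -- `between-corners`.
  switch : ∀ {k} (T : SSYT μ) {x y} → 2 + k ≤ n → S x → S y → e T x ≡ 2 + k → e T y ≡ suc k →
           Corner T (2 + k) x → Corner T (2 + k) y →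
           ∃ λ U → ∃ λ V → AgreeAbove k T U × Move U V × AgreeAbove (2 + k) T V × e V y ≡ 2 + k
  switch {k} T {x} {y} 2+k≤n x∈ y∈ ex ey x-corner y-corner with <-cmp (row x) (row y)
  ... | tri≈ _ eq _ = ⊥-elim (same-row (<-cmp (col x) (col y)))
    where
    same-row : _ → ⊥
    same-row (tri< lt _ _) = <⇒≱ (x-corner y∈ (inj₁ (eq , lt))) (≤-trans (≤-reflexive ey) (n≤1+n _))
    same-row (tri> _ _ lt) = <⇒≱ (y-corner x∈ (inj₁ (sym eq , lt))) (≤-reflexive ex)
    same-row (tri≈ _ eq′ _) = <-irrefl (trans (sym ey) (trans (cong (e T) (sym (cong₂ _,_ eq eq′))) ex)) (n<1+n _)
  ... | tri< x<y _ _ =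
    let U , TU , z , w , z∈ , w∈ , ez , ew , x≺z , z≺y , z≺w =
          between-corners T (<⇒≤ (<⇒≤ 2+k≤n)) y∈ x∈ x<y k<ey ey≤ k<ex x-corner (λ z∈ p q → swap (x-or-y z∈ p q))
    in finish U TU z∈ w∈ ez ew (inj₂ (x≺z , z≺y)) z≺w
    where open SwitchLemmas T 2+k≤n x∈ y∈ ex ey y-corner
  ... | tri> _ _ y<x =
    let U , TU , z , w , z∈ , w∈ , ez , ew , y≺z , z≺x , z≺w =
          between-corners T (<⇒≤ (<⇒≤ 2+k≤n)) x∈ y∈ y<x k<ex ex≤ k<ey y-corner x-or-y
    in finish U TU z∈ w∈ ez ew (inj₁ (y≺z , z≺x)) z≺w
    where open SwitchLemmas T 2+k≤n x∈ y∈ ex ey y-corner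

  -- Promoting the entry of `y` to `m` turns the cells of `m` and `suc m` into two corners that
  -- `switch` can treat. Both remaining gaps, from `T` to `U` and from `V` to `T′`, are agreements
  -- above `m`, ready for induction.
  exchange-top : ∀ {m} (T T′ : SSYT μ) {y} → suc m ≤ n → AgreeAbove (suc m) T T′ → S y →
                 e T′ y ≡ suc m → e T y ≢ suc m →
                 ∃ λ U → ∃ λ V → AgreeAbove m T U × Move U V × AgreeAbove m V T′
  exchange-top {m} T T′ {y} m<n TT′ y∈ e′y ey≢ = go m refl
    where
    ey≤m : e T y ≤ m
    ey≤m = ≤-pred (≤∧≢⇒< (≮⇒≥ λ m<ey → <⇒≢ m<ey (trans (sym e′y) (TT′ y∈ m<ey))) ey≢)
    go : ∀ m₀ → m₀ ≡ m → ∃ λ U → ∃ λ V → AgreeAbove m T U × Move U V × AgreeAbove m V T′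
    go zero refl = ⊥-elim (<⇒≱ (proj₁ (entry-range T y∈)) ey≤m)
    go (suc k) refl with promote-corner T (<⇒≤ m<n) y∈ ey≤m (λ z∈ y⋖z → <-trans (n<1+n _) (y-corner z∈ y⋖z))
                       | cellOf T (s≤s z≤n) m<n
      where
      -- Cells beyond `y` in its row or column have entries above `2 + k` in `T′`, and there `T`
      -- agrees with `T′`.
      y-corner : Corner T (2 + k) y
      y-corner z∈ y⋖z = subst (2 + k <_) (sym (agree-sym {T} {T′} TT′ z∈ lt)) lt
        where lt = subst (_< e T′ _) e′y (e-mono T′ y∈ z∈ y⋖z)
    ... | T₁ , e₁y , TT₁ | x , x∈ , ex =
      let U , V , T₁U , move , T₁V , eVy = switch T₁ m<n x∈ y∈ e₁x e₁y x-corner y-corner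
      in U , V , agree-trans {T} {T₁} {V = U} TT₁ (agree-weaken {T₁} {U} (n≤1+n k) T₁U) , move , VT′ V T₁V eVy
      where
      e₁x : e T₁ x ≡ 2 + k
      e₁x = trans (TT₁ x∈ (≤-reflexive (sym ex))) ex
      x-corner : Corner T₁ (2 + k) x
      x-corner z∈ x⋖z = subst (_< e T₁ _) e₁x (e-mono T₁ x∈ z∈ x⋖z)
      T₁T′ : AgreeAbove (2 + k) T₁ T′
      T₁T′ = agree-trans {T₁} {T} {V = T′} (agree-sym {T} {T₁} (agree-weaken {T} {T₁} (n≤1+n _) TT₁)) TT′
      y-corner : Corner T₁ (2 + k) y
      y-corner z∈ y⋖z = subst (2 + k <_) (sym (agree-sym {T₁} {T′} T₁T′ z∈ lt)) lt
        where lt = subst (_< e T′ _) e′y (e-mono T′ y∈ z∈ y⋖z)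
      VT′ : ∀ V → AgreeAbove (2 + k) T₁ V → e V y ≡ 2 + k → AgreeAbove (suc k) V T′
      VT′ V T₁V eVy z∈ lt with m≤n⇒m<n∨m≡n lt
      ... | inj₁ lt′ = agree-trans {V} {T₁} {V = T′} (agree-sym {T₁} {V} T₁V) T₁T′ z∈ lt′
      ... | inj₂ eq with refl ← e-injective V z∈ y∈ (trans (sym eq) (sym eVy)) = trans e′y (sym eVy)

  -- Composition of move sequences and the induction.

  Star-resp-≈ : ∀ {U U′ V : SSYT μ} → U ≈ U′ → Star Move U V → ∃ λ V′ → Star Move U′ V′ × V ≈ V′
  Star-resp-≈ {U} {U′} U≈U′ ε = U′ , ε , U≈U′
  -- Only the first move involves the starting representative, and only through its reading word.
  Star-resp-≈ {U} {U′} {V} U≈U′ ((i , 2≤i , i≤ , p) ◅ moves) = V , (i , 2≤i , i≤ , p′) ◅ moves , λ _ → refl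
    where p′ = trans p (cong (dᴿ i ∘ flip) (rw-cong U U′ U≈U′))

  Connected-trans : ∀ {T U V : SSYT μ} → Connected T U → Connected U V → Connected T V
  Connected-trans {T} {U} {V} (U′ , TU′ , U′≈U) (V′ , UV′ , V′≈V)
    with V″ , U′V″ , V′≈V″ ← Star-resp-≈ {U} {U′} {V′} (λ x∈ → sym (U′≈U x∈)) UV′ =
    V″ , TU′ ◅◅ U′V″ , λ x∈ → trans (sym (V′≈V″ x∈)) (V′≈V x∈)

  connected : ∀ m → m ≤ n → (T T′ : SSYT μ) → AgreeAbove m T T′ → Connected T T′
  -- All entries are positive, so agreement above 0 is `_≈_`.
  connected zero m≤n T T′ TT′ = T , ε , λ x∈ → sym (TT′ x∈ (proj₁ (entry-range T x∈)))
  connected (suc m) m<n T T′ TT′ with cellOf T′ (s≤s z≤n) m<n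
  ... | y , y∈ , e′y with e T y ≟ suc m
  ...   | yes ey = connected m (<⇒≤ m<n) T T′ agree
    where
    agree : AgreeAbove m T T′
    agree z∈ lt with m≤n⇒m<n∨m≡n lt
    ... | inj₁ lt′ = TT′ z∈ lt′
    ... | inj₂ eq with refl ← e-injective T z∈ y∈ (trans (sym eq) (sym ey)) = trans e′y (sym ey)
  ...   | no ey≢ =
    let U , V , TU , move , VT′ = exchange-top T T′ m<n TT′ y∈ e′y ey≢
    in Connected-trans {T} {U} {T′} (connected m (<⇒≤ m<n) T U TU)
         (Connected-trans {U} {V} {T′} (V , move ◅ ε , λ _ → refl) (connected m (<⇒≤ m<n) V T′ VT′))

proposition4p8 : ∀ (n : ℕ) (μ : StrictPartition n) →
    (∀ (i : ℕ) → 2 ≤ i → i + 2 ≤ n →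
    ∀ (T : SSYT μ) → ∃! _≈_ (λ (T′ : SSYT μ) → Moves i T T′))
    × (∀ (T T′ : SSYT μ) → Connected T T′)
proposition4p8 n μ =
  (λ i 2≤i i+2≤n T → Step.moves-∃! T (m+[n∸m]≡n (≤-trans (m≤m+n i 2) i+2≤n)) 2≤i
    (m+n≤o⇒m≤o∸n 2 (≤-trans (≤-reflexive (+-comm 2 i)) i+2≤n))) ,
  -- No entry exceeds `n`, so any two tableaux agree above `n` vacuously.
  (λ T T′ → connected n ≤-refl T T′ λ y∈ n< → ⊥-elim (<⇒≱ n< (proj₂ (SSYT.entry-range T y∈))))
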